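{- Let $p,p'$ be coprime with $1\le p<p'$ and let $p'/p$ have continued fraction $[c_0,c_1,\ldots,c_n]$ with $n\ge1$. Let $0\le\ell\le 2c_n-2$, $\hat p'=\xi_{\ell+1}-\xi_\ell$ and $\hat p=\tilde\xi_{\ell+1}-\tilde\xi_\ell$. Then for every $1\le s\le \hat p'-2$, the parity of the $s$th band of the $(\hat p,\hat p')$-model equals the parity of the $(\xi_\ell+s)$th band of the $(p,p')$-model; that is, $\lfloor s\hat p/\hat p'\rfloor\ne\lfloor (s+1)\hat p/\hat p'\rfloor$ if and only if $\lfloor (\xi_\ell+s)p/p'\rfloor\ne\lfloor (\xi_\ell+s+1)p/p'\rfloor$.
   Context: The continued fraction $[c_0,\ldots,c_n]$ of $p'/p$ has $c_i\ge1$ ($i<n$), $c_n\ge2$, $p'/p=c_0+1/(c_1+1/(\cdots+1/c_n))$. Define $y_{ -1}=0,y_0=1$, $z_{ -1}=1,z_0=0$, $y_k=c_{k-1}y_{k-1}+y_{k-2}$, $z_k=c_{k-1}z_{k-1}+z_{k-2}$ for $1\le k\le n+1$. Define $\xi_0=\tilde\xi_0=0$, $\xi_{2c_n-1}=p'$, $\tilde\xi_{2c_n-1}=p$, and for $1\le k<c_n$: $\xi_{2k-1}=ky_n$, $\xi_{2k}=ky_n+y_{n-1}$, $\tilde\xi_{2k-1}=kz_n$, $\tilde\xi_{2k}=kz_n+z_{n-1}$. For positive integer $q'$ and integer $q\ge0$, the $h$th band ($1\le h\le q'-2$) of the $(q,q')$-model is odd if $\lfloor hq/q'\rfloor\ne\lfloor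 (h+1)q/q'\rfloor$ and even otherwise. -}

module Defs where

open import Data.Nat using (ℕ; zero; suc; _+_; _*_; _∸_; _/_; _≟_)
open import Data.Nat.DivMod using ()
open import Data.Product using (_×_; _,_; proj₁; proj₂)
open import Data.Bool using (Bool; true; false; if_then_else_)
open import Relation.Nullary using (¬_; does)
open import Relation.Binary.PropositionalEquality using (_≡_)

-- Continued fraction [c_i, c_{i+1}, ..., c_{i+m}] evaluated as a pair
-- (numerator , denominator):  [c] = c/1,  [c, rest] = c + 1/(a/b) = (c*a+b)/a.
cfEval : (ℕ → ℕ) → ℕ → ℕ → ℕ × ℕ
cfEval c i zero = c i , 1
cfEval c i (suc m) with cfEval c (suc i) m
... | a , b = c i * a + b , a

-- "q'/q has continued fraction [c_0,...,c_n]" (c_i ≥ 1 for i < n, c_n ≥ 2),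
-- with the value equality stated as equality of rationals (cross-multiplied).
record IsCF (q' q n : ℕ) (c : ℕ → ℕ) : Set where
  field
    pos  : ∀ i → i Data.Nat.< n → 1 Data.Nat.≤ c i
    last : 2 Data.Nat.≤ c n
    val  : q' * proj₂ (cfEval c 0 n) ≡ proj₁ (cfEval c 0 n) * q

-- Sequences with given initial values u_{-1}, u_0 and u_k = c_{k-1} u_{k-1} + u_{k-2}.
-- seqPair c a b k = (u_{k-1} , u_k), where u_{-1} = a, u_0 = b.
seqPair : (ℕ → ℕ) → ℕ → ℕ → ℕ → ℕ × ℕ
seqPair c a b zero = a , b
seqPair c a b (suc k) with seqPair c a b k
... | u , v = v , c k * v + u

-- y_k  (y_{-1} = 0, y_0 = 1), given as y k  for k ≥ 0, and y_{k-1} as yPrev k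
y : (ℕ → ℕ) → ℕ → ℕ
y c k = proj₂ (seqPair c 0 1 k)

yPrev : (ℕ → ℕ) → ℕ → ℕ
yPrev c k = proj₁ (seqPair c 0 1 k)   -- = y_{k-1}

-- z_k  (z_{-1} = 1, z_0 = 0)
z : (ℕ → ℕ) → ℕ → ℕ
z c k = proj₂ (seqPair c 1 0 k)

zPrev : (ℕ → ℕ) → ℕ → ℕ
zPrev c k = proj₁ (seqPair c 1 0 k)   -- = z_{k-1}

-- Generic ξ-type sequence, for 0 ≤ k ≤ 2 cn - 1:
--   k = 0          ↦ 0
--   k = 2 cn - 1   ↦ top
--   k = 2j - 1     ↦ j * u        (1 ≤ j < cn)
--   k = 2j         ↦ j * u + u'   (1 ≤ j < cn)
xiGen : (cn top u u' : ℕ) → ℕ → ℕ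
xiGen cn top u u' zero = 0
xiGen cn top u u' (suc k) =
  if does (suc k ≟ 2 * cn ∸ 1) then top
  else (if does (k Data.Nat.% 2 ≟ 0)
          then (suc k / 2 + 1) * u        -- suc k = 2j - 1, j = (k/2) + 1
          else (suc k / 2) * u + u')      -- suc k = 2j

-- ξ_k for the continued fraction c of p'/p with last index n
ξ : (p' : ℕ) (n : ℕ) (c : ℕ → ℕ) → ℕ → ℕ
ξ p' n c = xiGen (c n) p' (y c n) (yPrev c n)

-- ξ̃_k
ξ̃ : (p : ℕ) (n : ℕ) (c : ℕ → ℕ) → ℕ → ℕ
ξ̃ p n c = xiGen (c n) p (z c n) (zPrev c n)

-- floor(a / b); b = 0 never occurs in the statement's relevant range
⌊_/_⌋ : ℕ → ℕ → ℕ
⌊ a / zero ⌋ = 0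
⌊ a / suc b ⌋ = a / suc b

-- the h-th band of the (q,q')-model is odd
OddBand : (q q' h : ℕ) → Set
OddBand q q' h = ¬ (⌊ h * q / q' ⌋ ≡ ⌊ (h + 1) * q / q' ⌋)

{-# OPTIONS --safe #-}
-- Let Y = (y_n , z_n) and Y' = (y_{n-1} , z_{n-1}), so det (Y , Y') = ±1 and, both fractions being
-- reduced, (p' , p) = (y_{n+1} , z_{n+1}) = c_n Y + Y'. The deviation det (P , (p' , p)) of a lattice
-- point P from the line through (p' , p) is then ±k at k Y and ∓(c_n − k) at k Y + Y': consecutive
-- points (ξ_ℓ , ξ̃_ℓ) lie on opposite sides of the line, with deviations at most c_n. Each step
-- (Q' , Q) is Y, Y' or Y − Y', hence primitive with Q' ≤ y_n. Interpolating along a step from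
-- (A , Ã), (A + t) p / p' is less than 1 / Q' away from Ã + t Q / Q', which for 0 < t < Q' is at
-- least 1 / Q' away from every integer; so ⌊ (A + t) p / p' ⌋ = Ã + ⌊ t Q / Q' ⌋ along the whole
-- step, and the band parities coincide.
module Submission where

open import Defs
open import Data.List.Base using (_∷_; [])
open import Data.Nat using (ℕ; zero; suc; _+_; _*_; _∸_; _≤_; _<_; _/_; _%_; _≟_; s≤s; z≤n; z<s; NonZero; >-nonZero)
open import Data.Nat.Coprimality as Coprimality using (Coprime; coprime-divisor)
open import Data.Nat.Divisibility using (_∣_; ∣m+n∣m⇒∣n; ∣1⇒≡1; ∣m⇒∣m*n; m∣m*n; n∣m*n; ∣-antisym; ∣⇒≤; m%n≡0⇒n∣m)
open import Data.Nat.DivMod using (m≡m%n+[m/n]*n; m%n<n; m<n*o⇒m/o<n; /-monoˡ-≤; m*n/n≡m; m*n%n≡0; +-distrib-/-∣ʳ; [m+kn]%n≡m%n)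
open import Data.Nat.Properties
open import Data.Nat.Tactic.RingSolver using (solve; solve-∀)
open import Data.Product using (_×_; _,_; proj₁; proj₂; ∃)
open import Data.Sign.Base as Sign using (Sign; opposite)
open import Data.Sum using (_⊎_; inj₁; inj₂)
open import Function.Base using (_∘_)
open import Function.Bundles using (_⇔_; mk⇔)
open import Relation.Binary.PropositionalEquality
open import Relation.Nullary using (¬_)
open import Relation.Nullary.Decidable using (dec-true; dec-false)

-- Det σ (a , ã) (b , b̃) d  says  a b̃ − ã b = σ d.
data Det : Sign → ℕ × ℕ → ℕ × ℕ → ℕ → Set where
  det+ : ∀ {a ã b b̃ d} → ã * b + d ≡ a * b̃ → Det Sign.+ (a , ã) (b , b̃) d
  det- : ∀ {a ã b b̃ d} → a * b̃ + d ≡ ã * b → Det Sign.- (a , ã) (b , b̃) d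

det-antisym : ∀ {σ u v d} → Det σ u v d → Det (opposite σ) v u d
det-antisym (det+ {a} {ã} {b} {b̃} {d} h) = det- (trans (cong (_+ d) (*-comm b ã)) (trans h (*-comm a b̃)))
det-antisym (det- {a} {ã} {b} {b̃} {d} h) = det+ (trans (cong (_+ d) (*-comm b̃ a)) (trans h (*-comm ã b)))

det-zeroˡ : ∀ {σ v} → Det σ (0 , 0) v 0
det-zeroˡ {Sign.+} = det+ refl
det-zeroˡ {Sign.-} = det- refl

det-self : ∀ {σ u} → Det σ u u 0
det-self {Sign.+} {a , ã} = det+ (trans (+-identityʳ (ã * a)) (*-comm ã a))
det-self {Sign.-} {a , ã} = det- (trans (+-identityʳ (a * ã)) (*-comm a ã))

det-scaleˡ : ∀ {σ a ã v d} k → Det σ (a , ã) v d → Det σ (k * a , k * ã) v (k * d)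
det-scaleˡ k (det+ {a} {ã} {b} {b̃} {d} h) = det+ (begin
  k * ã * b + k * d ≡⟨ solve (k ∷ ã ∷ b ∷ d ∷ []) ⟩
  k * (ã * b + d)   ≡⟨ cong (k *_) h ⟩
  k * (a * b̃)       ≡⟨ solve (k ∷ a ∷ b̃ ∷ []) ⟩
  k * a * b̃         ∎)
  where open ≡-Reasoning
det-scaleˡ k (det- {a} {ã} {b} {b̃} {d} h) = det- (begin
  k * a * b̃ + k * d ≡⟨ solve (k ∷ a ∷ b̃ ∷ d ∷ []) ⟩
  k * (a * b̃ + d)   ≡⟨ cong (k *_) h ⟩
  k * (ã * b)       ≡⟨ solve (k ∷ ã ∷ b ∷ []) ⟩
  k * ã * b         ∎)
  where open ≡-Reasoning

det-shearʳ : ∀ {σ a ã b b̃ d} k → Det σ (a , ã) (b , b̃) d → Det σ (a , ã) (k * a + b , k * ã + b̃) d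
det-shearʳ k (det+ {a} {ã} {b} {b̃} {d} h) = det+ (begin
  ã * (k * a + b) + d     ≡⟨ solve (ã ∷ k ∷ a ∷ b ∷ d ∷ []) ⟩
  k * a * ã + (ã * b + d) ≡⟨ cong (k * a * ã +_) h ⟩
  k * a * ã + a * b̃       ≡⟨ solve (k ∷ a ∷ ã ∷ b̃ ∷ []) ⟩
  a * (k * ã + b̃)         ∎)
  where open ≡-Reasoning
det-shearʳ k (det- {a} {ã} {b} {b̃} {d} h) = det- (begin
  a * (k * ã + b̃) + d     ≡⟨ solve (a ∷ k ∷ ã ∷ b̃ ∷ d ∷ []) ⟩
  k * a * ã + (a * b̃ + d) ≡⟨ cong (k * a * ã +_) h ⟩
  k * a * ã + ã * b       ≡⟨ solve (k ∷ a ∷ ã ∷ b ∷ []) ⟩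
  ã * (k * a + b)         ∎)
  where open ≡-Reasoning

det-unshearˡ : ∀ {σ a ã b b̃ d} → Det σ (b + a , b̃ + ã) (b , b̃) d → Det σ (a , ã) (b , b̃) d
det-unshearˡ {a = a} {ã} {b} {b̃} {d} (det+ h) = det+ (+-cancelˡ-≡ (b̃ * b) _ _ (begin
  b̃ * b + (ã * b + d) ≡⟨ solve (b̃ ∷ b ∷ ã ∷ d ∷ []) ⟩
  (b̃ + ã) * b + d     ≡⟨ h ⟩
  (b + a) * b̃         ≡⟨ solve (b ∷ a ∷ b̃ ∷ []) ⟩
  b̃ * b + a * b̃       ∎))
  where open ≡-Reasoning
det-unshearˡ {a = a} {ã} {b} {b̃} {d} (det- h) = det- (+-cancelˡ-≡ (b * b̃) _ _ (begin
  b * b̃ + (a * b̃ + d) ≡⟨ solve (b ∷ b̃ ∷ a ∷ d ∷ []) ⟩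
  (b + a) * b̃ + d     ≡⟨ h ⟩
  (b̃ + ã) * b         ≡⟨ solve (b̃ ∷ ã ∷ b ∷ []) ⟩
  b * b̃ + ã * b       ∎))
  where open ≡-Reasoning

det-sheared : ∀ {σ a ã b b̃ d k e c} → k + e ≡ c → Det σ (a , ã) (b , b̃) d →
              Det σ (c * a + b , c * ã + b̃) (k * a + b , k * ã + b̃) (e * d)
det-sheared {k = k} {e} refl (det+ {a} {ã} {b} {b̃} {d} h) = det+ (begin
  ((k + e) * ã + b̃) * (k * a + b) + e * d ≡⟨ solve (k ∷ e ∷ ã ∷ b̃ ∷ a ∷ b ∷ d ∷ []) ⟩
  (k + e) * k * a * ã + k * ã * b + k * a * b̃ + b * b̃ + e * (ã * b + d)
    ≡⟨ cong (λ x → (k + e) * k * a * ã + k * ã * b + k * a * b̃ + b * b̃ + e * x) h ⟩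
  (k + e) * k * a * ã + k * ã * b + k * a * b̃ + b * b̃ + e * (a * b̃)
    ≡⟨ solve (k ∷ e ∷ a ∷ ã ∷ b ∷ b̃ ∷ []) ⟩
  ((k + e) * a + b) * (k * ã + b̃)         ∎)
  where open ≡-Reasoning
det-sheared {k = k} {e} refl (det- {a} {ã} {b} {b̃} {d} h) = det- (begin
  ((k + e) * a + b) * (k * ã + b̃) + e * d ≡⟨ solve (k ∷ e ∷ a ∷ b ∷ ã ∷ b̃ ∷ d ∷ []) ⟩
  (k + e) * k * a * ã + k * ã * b + k * a * b̃ + b * b̃ + e * (a * b̃ + d)
    ≡⟨ cong (λ x → (k + e) * k * a * ã + k * ã * b + k * a * b̃ + b * b̃ + e * x) h ⟩
  (k + e) * k * a * ã + k * ã * b + k * a * b̃ + b * b̃ + e * (ã * b)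
    ≡⟨ solve (k ∷ e ∷ a ∷ ã ∷ b ∷ b̃ ∷ []) ⟩
  ((k + e) * ã + b̃) * (k * a + b)         ∎)
  where open ≡-Reasoning

det-coprime : ∀ {σ a ã v} → Det σ (a , ã) v 1 → Coprime a ã
det-coprime (det+ {a} {ã} {b} {b̃} h) {i} (i∣a , i∣ã) =
  ∣1⇒≡1 (∣m+n∣m⇒∣n (subst (i ∣_) (sym h) (∣m⇒∣m*n b̃ i∣a)) (∣m⇒∣m*n b i∣ã))
det-coprime (det- {a} {ã} {b} {b̃} h) {i} (i∣a , i∣ã) =
  ∣1⇒≡1 (∣m+n∣m⇒∣n (subst (i ∣_) (sym h) (∣m⇒∣m*n b i∣ã)) (∣m⇒∣m*n b̃ i∣a))

q*d≤n<[1+q]*d⇒n/d≡q : ∀ {n d q} .{{_ : NonZero d}} → q * d ≤ n → n < suc q * d → n / d ≡ q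
q*d≤n<[1+q]*d⇒n/d≡q {n} {d} {q} lo hi =
  ≤-antisym (≤-pred (m<n*o⇒m/o<n hi)) (subst (_≤ n / d) (m*n/n≡m q d) (/-monoˡ-≤ d lo))

-- As rationals, N / P' and Ã + k / Q' differ by (v − u) / (Q' P'), which is less than 1 / Q' in
-- absolute value, while k / Q' is at least 1 / Q' away from every integer.
/-≡-of-close : ∀ {N P' Ã k Q' u v} .{{_ : NonZero P'}} .{{_ : NonZero Q'}} →
          ¬ Q' ∣ k → Q' * N + u ≡ (Q' * Ã + k) * P' + v → u < P' → v < P' →
          N / P' ≡ Ã + k / Q'
/-≡-of-close {N} {P'} {Ã} {k} {Q'} {u} {v} Q'∤k eq u<P' v<P' =
  q*d≤n<[1+q]*d⇒n/d≡q (<⇒≤ (*-cancelˡ-< Q' _ _ lower)) (*-cancelˡ-< Q' _ _ upper)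
  where
  q = Ã + k / Q'
  r = k % Q'

  split : Q' * N + u ≡ Q' * (q * P') + (v + r * P')
  split = begin
    Q' * N + u                                 ≡⟨ eq ⟩
    (Q' * Ã + k) * P' + v                      ≡⟨ cong (λ x → (Q' * Ã + x) * P' + v) (m≡m%n+[m/n]*n k Q') ⟩
    (Q' * Ã + (r + k / Q' * Q')) * P' + v      ≡⟨ regroup Q' Ã r (k / Q') P' v ⟩
    Q' * (q * P') + (v + r * P')               ∎
    where
    open ≡-Reasoning
    regroup : ∀ Q' Ã r m P' v → (Q' * Ã + (r + m * Q')) * P' + v ≡ Q' * ((Ã + m) * P') + (v + r * P')
    regroup = solve-∀

  1≤r : 1 ≤ r
  1≤r = n≢0⇒n>0 (λ r≡0 → Q'∤k (m%n≡0⇒n∣m k Q' r≡0))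

  P'≤rP' : P' ≤ r * P'
  P'≤rP' = m≤n*m P' r {{>-nonZero 1≤r}}

  lower : Q' * (q * P') < Q' * N
  lower = +-cancelʳ-< P' _ _ (begin-strict
    Q' * (q * P') + P'           ≤⟨ +-monoʳ-≤ (Q' * (q * P')) (≤-trans P'≤rP' (m≤n+m (r * P') v)) ⟩
    Q' * (q * P') + (v + r * P') ≡⟨ split ⟨
    Q' * N + u                   <⟨ +-monoʳ-< (Q' * N) u<P' ⟩
    Q' * N + P'                  ∎)
    where open ≤-Reasoning

  upper : Q' * N < Q' * (suc q * P')
  upper = begin-strict
    Q' * N                        ≤⟨ m≤m+n (Q' * N) u ⟩
    Q' * N + u                    ≡⟨ split ⟩
    Q' * (q * P') + (v + r * P')  <⟨ +-monoʳ-< (Q' * (q * P')) (+-monoˡ-< (r * P') v<P') ⟩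
    Q' * (q * P') + suc r * P'    ≤⟨ +-monoʳ-≤ (Q' * (q * P')) (*-monoˡ-≤ P' (m%n<n k Q')) ⟩
    Q' * (q * P') + Q' * P'       ≡⟨ +-comm (Q' * (q * P')) (Q' * P') ⟩
    Q' * P' + Q' * (q * P')       ≡⟨ *-distribˡ-+ Q' P' (q * P') ⟨
    Q' * (suc q * P')             ∎
    where open ≤-Reasoning

-- The segment from (A , Ã) to (A + Q' , Ã + Q) crosses the line through (0 , 0) and (p' , p):
-- det (A , Ã) (p' , p) and det (p' , p) (A + Q' , Ã + Q) have the same sign.
record Crossing (p p' A Ã Q Q' : ℕ) : Set where
  constructor crossing
  field
    side : Sign
    start-deviation end-deviation : ℕ
    start : Det side (A , Ã) (p' , p) start-deviation
    end : Det side (p' , p) (A + Q' , Ã + Q) end-deviation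
    start-deviation-bound : start-deviation * Q' ≤ p'
    end-deviation-bound : end-deviation * Q' ≤ p'
    coprime : Coprime Q Q'

-- Both identities are (Q' − t) · start + t · end: along the segment, Q' times the deviation
-- interpolates linearly between the deviations at the endpoints.
interpolate-below : ∀ {p p' A Ã Q Q' a b t w} →
  Ã * p' + a ≡ A * p → p * (A + Q') + b ≡ p' * (Ã + Q) → t + w ≡ Q' →
  Q' * ((A + t) * p) + t * b ≡ (Q' * Ã + t * Q) * p' + w * a
interpolate-below {p} {p'} {A} {Ã} {Q} {a = a} {b} {t} {w} start end refl = begin
  (t + w) * ((A + t) * p) + t * b             ≡⟨ solve (t ∷ w ∷ A ∷ p ∷ b ∷ []) ⟩
  w * (A * p) + t * (p * (A + (t + w)) + b)   ≡⟨ cong₂ (λ x y → w * x + t * y) (sym start) end ⟩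
  w * (Ã * p' + a) + t * (p' * (Ã + Q))       ≡⟨ solve (w ∷ Ã ∷ p' ∷ a ∷ t ∷ Q ∷ []) ⟩
  ((t + w) * Ã + t * Q) * p' + w * a          ∎
  where open ≡-Reasoning

interpolate-above : ∀ {p p' A Ã Q Q' a b t w} →
  A * p + a ≡ Ã * p' → p' * (Ã + Q) + b ≡ p * (A + Q') → t + w ≡ Q' →
  Q' * ((A + t) * p) + w * a ≡ (Q' * Ã + t * Q) * p' + t * b
interpolate-above {p} {p'} {A} {Ã} {Q} {a = a} {b} {t} {w} start end refl = begin
  (t + w) * ((A + t) * p) + w * a             ≡⟨ solve (t ∷ w ∷ A ∷ p ∷ a ∷ []) ⟩
  w * (A * p + a) + t * (p * (A + (t + w)))   ≡⟨ cong₂ (λ x y → w * x + t * y) start (sym end) ⟩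
  w * (Ã * p') + t * (p' * (Ã + Q) + b)       ≡⟨ solve (w ∷ p' ∷ Ã ∷ t ∷ Q ∷ b ∷ []) ⟩
  ((t + w) * Ã + t * Q) * p' + t * b          ∎
  where open ≡-Reasoning

m<n⇒o*n≤p⇒m*o<p : ∀ {m n o p} → 0 < p → m < n → o * n ≤ p → m * o < p
m<n⇒o*n≤p⇒m*o<p {m} {o = zero} {p} 0<p _ _ = subst (_< p) (sym (*-zeroʳ m)) 0<p
m<n⇒o*n≤p⇒m*o<p {m} {n} {suc o} _ m<n [1+o]*n≤p =
  <-≤-trans (*-monoˡ-< (suc o) m<n) (≤-trans (≤-reflexive (*-comm n (suc o))) [1+o]*n≤p)

crossing-floor : ∀ {p p' A Ã Q Q' t} → 0 < p' → Crossing p p' A Ã Q Q' → 1 ≤ t → t < Q' →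
                 ⌊ (A + t) * p / p' ⌋ ≡ Ã + ⌊ t * Q / Q' ⌋
crossing-floor {p} {p'@(suc _)} {A} {Ã} {Q} {Q'@(suc _)} {t} 0<p'
               (crossing _ a b start end a-bound b-bound coprime) 1≤t t<Q' = shift start end
  where
  w = proj₁ (m≤n⇒∃[o]m+o≡n (<⇒≤ t<Q'))
  t+w≡Q' : t + w ≡ Q'
  t+w≡Q' = proj₂ (m≤n⇒∃[o]m+o≡n (<⇒≤ t<Q'))

  Q'∤tQ : ¬ Q' ∣ t * Q
  Q'∤tQ Q'∣tQ = <⇒≱ t<Q' (∣⇒≤ {{>-nonZero 1≤t}}
    (coprime-divisor (Coprimality.sym coprime) (subst (Q' ∣_) (*-comm t Q) Q'∣tQ)))

  tb<p' : t * b < p'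
  tb<p' = m<n⇒o*n≤p⇒m*o<p 0<p' t<Q' b-bound
  wa<p' : w * a < p'
  wa<p' = m<n⇒o*n≤p⇒m*o<p 0<p' (subst (w <_) t+w≡Q' (m<n+m w 1≤t)) a-bound

  shift : ∀ {σ} → Det σ (A , Ã) (p' , p) a → Det σ (p' , p) (A + Q' , Ã + Q) b →
          (A + t) * p / p' ≡ Ã + t * Q / Q'
  shift (det+ start) (det+ end) = /-≡-of-close {(A + t) * p} {k = t * Q} Q'∤tQ
    (interpolate-below {p} {p'} {A} {Ã} {Q} {Q'} {t = t} start end t+w≡Q') tb<p' wa<p'
  shift (det- start) (det- end) = /-≡-of-close {(A + t) * p} {k = t * Q} Q'∤tQ
    (interpolate-above {p} {p'} {A} {Ã} {Q} {Q'} {t = t} start end t+w≡Q') wa<p' tb<p'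

bands-agree : ∀ {P P' A Ã Q Q' s} →
  (∀ {t} → 1 ≤ t → t < Q' → ⌊ (A + t) * P / P' ⌋ ≡ Ã + ⌊ t * Q / Q' ⌋) →
  1 ≤ s → s + 1 < Q' → OddBand Q Q' s ⇔ OddBand P P' (A + s)
bands-agree {P} {P'} {A} {Ã} {Q} {Q'} {s} floor 1≤s s+1<Q' =
  mk⇔ (λ odd eq → odd (+-cancelˡ-≡ Ã _ _ (trans (sym at-s) (trans eq at-s+1))))
      (λ odd eq → odd (trans at-s (trans (cong (Ã +_) eq) (sym at-s+1))))
  where
  at-s : ⌊ (A + s) * P / P' ⌋ ≡ Ã + ⌊ s * Q / Q' ⌋
  at-s = floor 1≤s (<-trans (m<m+n s z<s) s+1<Q')
  at-s+1 : ⌊ (A + s + 1) * P / P' ⌋ ≡ Ã + ⌊ (s + 1) * Q / Q' ⌋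
  at-s+1 = trans (cong (λ x → ⌊ x * P / P' ⌋) (+-assoc A s 1)) (floor (m≤n+m 1 s) s+1<Q')

last-index : ∀ m → 2 * (2 + m) ∸ 1 ≡ 3 + 2 * m
last-index m = cong (_∸ 1) (*-distribˡ-+ 2 2 m)

below-last-index : ∀ {m i} → i < 3 + 2 * m → i ≢ 2 * (2 + m) ∸ 1
below-last-index {m} i< eq = <⇒≢ i< (trans eq (last-index m))

[2*j]%2≡0 : ∀ j → 2 * j % 2 ≡ 0
[2*j]%2≡0 j = trans (cong (_% 2) (*-comm 2 j)) (m*n%n≡0 j 2)

[1+2*j]%2≡1 : ∀ j → (1 + 2 * j) % 2 ≡ 1
[1+2*j]%2≡1 j = trans (cong (λ x → (1 + x) % 2) (*-comm 2 j)) ([m+kn]%n≡m%n 1 j 2)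

[i+2*j]/2≡i/2+j : ∀ i j → (i + 2 * j) / 2 ≡ i / 2 + j
[i+2*j]/2≡i/2+j i j = begin
  (i + 2 * j) / 2     ≡⟨ cong (λ x → (i + x) / 2) (*-comm 2 j) ⟩
  (i + j * 2) / 2     ≡⟨ +-distrib-/-∣ʳ i (n∣m*n j {2}) ⟩
  i / 2 + j * 2 / 2   ≡⟨ cong (i / 2 +_) (m*n/n≡m j 2) ⟩
  i / 2 + j           ∎
  where open ≡-Reasoning

xi-odd : ∀ {m j} top u u' → j ≤ m → xiGen (2 + m) top u u' (1 + 2 * j) ≡ (1 + j) * u
xi-odd {m} {j} top u u' j≤m
  rewrite dec-false (1 + 2 * j ≟ 2 * (2 + m) ∸ 1) (below-last-index (s≤s (s≤s (m≤n⇒m≤1+n (*-monoʳ-≤ 2 j≤m)))))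
        | dec-true (2 * j % 2 ≟ 0) ([2*j]%2≡0 j)
        | [i+2*j]/2≡i/2+j 1 j
        = cong (_* u) (+-comm j 1)

xi-even : ∀ {m j} top u u' → j ≤ m → xiGen (2 + m) top u u' (2 + 2 * j) ≡ (1 + j) * u + u'
xi-even {m} {j} top u u' j≤m
  rewrite dec-false (2 + 2 * j ≟ 2 * (2 + m) ∸ 1) (below-last-index (s≤s (s≤s (s≤s (*-monoʳ-≤ 2 j≤m)))))
        | dec-false ((1 + 2 * j) % 2 ≟ 0) (λ eq → 1+n≢0 (trans (sym ([1+2*j]%2≡1 j)) eq))
        | [i+2*j]/2≡i/2+j 2 j
        = refl

xi-last : ∀ m top u u' → xiGen (2 + m) top u u' (3 + 2 * m) ≡ top
xi-last m top u u' rewrite dec-true (3 + 2 * m ≟ 2 * (2 + m) ∸ 1) (sym (last-index m)) = refl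

-- With c = 2 + m and k = 1 + j, the segment [ξ ℓ , ξ (ℓ + 1)] is [0 , y], [k y , k y + y'],
-- [k y + y' , (k + 1) y] or [(c − 1) y + y' , p'] according to the constructor.
data StepIndex (m : ℕ) : ℕ → Set where
  first : StepIndex m 0
  odd   : ∀ {j} → j ≤ m → StepIndex m (1 + 2 * j)
  even  : ∀ {j} → j < m → StepIndex m (2 + 2 * j)
  last  : StepIndex m (2 + 2 * m)

even-or-odd : ∀ ℓ → (∃ λ j → ℓ ≡ 2 * j) ⊎ (∃ λ j → ℓ ≡ 1 + 2 * j)
even-or-odd zero = inj₁ (0 , refl)
even-or-odd (suc ℓ) with even-or-odd ℓ
... | inj₁ (j , refl) = inj₂ (j , refl)
... | inj₂ (j , refl) = inj₁ (suc j , sym (*-suc 2 j))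

step-index : ∀ {m ℓ} → ℓ ≤ 2 + 2 * m → StepIndex m ℓ
step-index {m} {ℓ} ℓ≤ with even-or-odd ℓ
... | inj₂ (j , refl) = odd (≤-pred (*-cancelˡ-< 2 j (suc m) (subst (2 * j <_) (sym (*-suc 2 m)) ℓ≤)))
... | inj₁ (zero , refl) = first
... | inj₁ (suc j , refl) =
  subst (StepIndex m) (sym (*-suc 2 j))
    (even-or-last (*-cancelˡ-≤ 2 (subst (2 * suc j ≤_) (sym (*-suc 2 m)) ℓ≤)))
  where
  even-or-last : suc j ≤ suc m → StepIndex m (2 + 2 * j)
  even-or-last j<1+m with m≤n⇒m<n∨m≡n (≤-pred j<1+m)
  ... | inj₁ j<m = even j<m
  ... | inj₂ refl = last

record CrossingStep (p p' : ℕ) (X X̃ : ℕ → ℕ) (ℓ : ℕ) : Set where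
  field
    Q Q' : ℕ
    X-step : X (suc ℓ) ≡ X ℓ + Q'
    X̃-step : X̃ (suc ℓ) ≡ X̃ ℓ + Q
    segment : Crossing p p' (X ℓ) (X̃ ℓ) Q Q'

-- (y₁ , z₁) and (y₀ , z₀) stand for (y_n , z_n) and (y_{n-1} , z_{n-1}), and c for c_n.
module _ {σ : Sign} (m w w̃ : ℕ) {y₀ z₀ : ℕ} (det : Det σ (y₀ + w , z₀ + w̃) (y₀ , z₀) 1) where

  private
    c y₁ z₁ p' p : ℕ
    c = 2 + m
    y₁ = y₀ + w
    z₁ = z₀ + w̃
    p' = c * y₁ + y₀
    p = c * z₁ + z₀

    X X̃ : ℕ → ℕ
    X = xiGen c p' y₁ y₀
    X̃ = xiGen c p z₁ z₀

    crossing-step : ∀ {ℓ A Ã Q Q'} → X ℓ ≡ A → X̃ ℓ ≡ Ã → X (suc ℓ) ≡ A + Q' → X̃ (suc ℓ) ≡ Ã + Q →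
                    Crossing p p' A Ã Q Q' → CrossingStep p p' X X̃ ℓ
    crossing-step refl refl X-step X̃-step segment =
      record { X-step = X-step ; X̃-step = X̃-step ; segment = segment }

    deviation-multiple : ∀ k → Det σ (k * y₁ , k * z₁) (p' , p) k
    deviation-multiple k =
      subst (Det σ (k * y₁ , k * z₁) (p' , p)) (*-identityʳ k) (det-scaleˡ k (det-shearʳ c det))

    deviation-sheared : ∀ {k e} → k + e ≡ c → Det σ (p' , p) (k * y₁ + y₀ , k * z₁ + z₀) e
    deviation-sheared {k} {e} k+e≡c =
      subst (Det σ (p' , p) (k * y₁ + y₀ , k * z₁ + z₀)) (*-identityʳ e) (det-sheared {k = k} k+e≡c det)

    deviation-bound : ∀ {k q} → k ≤ c → q ≤ y₁ → k * q ≤ p'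
    deviation-bound k≤c q≤y₁ = ≤-trans (*-mono-≤ k≤c q≤y₁) (m≤m+n (c * y₁) y₀)

    summand-≤ : ∀ k e → k + e ≡ c → e ≤ c
    summand-≤ k e k+e≡c = subst (e ≤_) k+e≡c (m≤n+m e k)

  first-step : CrossingStep p p' X X̃ 0
  first-step =
    crossing-step refl refl
      (trans (xi-odd p' y₁ y₀ (z≤n {m})) (*-identityˡ y₁)) (trans (xi-odd p z₁ z₀ (z≤n {m})) (*-identityˡ z₁))
      (crossing (opposite σ) 0 1 det-zeroˡ (det-antisym (det-shearʳ c det))
        z≤n (deviation-bound (s≤s z≤n) ≤-refl) (Coprimality.sym (det-coprime det)))

  odd-step : ∀ {j} → j ≤ m → CrossingStep p p' X X̃ (1 + 2 * j)
  odd-step {j} j≤m with m≤n⇒∃[o]m+o≡n (s≤s (m≤n⇒m≤1+n j≤m))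
  ... | e , 1+j+e≡c =
    crossing-step (xi-odd p' y₁ y₀ j≤m) (xi-odd p z₁ z₀ j≤m) (xi-even p' y₁ y₀ j≤m) (xi-even p z₁ z₀ j≤m)
      (crossing σ (1 + j) e (deviation-multiple (1 + j)) (deviation-sheared 1+j+e≡c)
        (deviation-bound (s≤s (m≤n⇒m≤1+n j≤m)) (m≤m+n y₀ w))
        (deviation-bound (summand-≤ (1 + j) e 1+j+e≡c) (m≤m+n y₀ w))
        (Coprimality.sym (det-coprime (det-antisym det))))

  even-step : ∀ {j} → j < m → CrossingStep p p' X X̃ (2 + 2 * j)
  even-step {j} j<m with m≤n⇒∃[o]m+o≡n (s≤s (m≤n⇒m≤1+n (<⇒≤ j<m)))
  ... | e , 1+j+e≡c =
    crossing-step (xi-even p' y₁ y₀ (<⇒≤ j<m)) (xi-even p z₁ z₀ (<⇒≤ j<m)) X-next X̃-next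
      (crossing (opposite σ) e (2 + j) (det-antisym (deviation-sheared 1+j+e≡c))
        (subst₂ (λ a ã → Det (opposite σ) (p' , p) (a , ã) (2 + j))
          (regroup j y₀ w) (regroup j z₀ w̃) (det-antisym (deviation-multiple (2 + j))))
        (deviation-bound (summand-≤ (1 + j) e 1+j+e≡c) (m≤n+m w y₀))
        (deviation-bound (s≤s (s≤s (<⇒≤ j<m))) (m≤n+m w y₀))
        (Coprimality.sym (det-coprime (det-unshearˡ det))))
    where
    regroup : ∀ k a b → (2 + k) * (a + b) ≡ (1 + k) * (a + b) + a + b
    regroup = solve-∀

    X-next : X (3 + 2 * j) ≡ (1 + j) * y₁ + y₀ + w
    X-next = trans (cong (λ i → X (suc i)) (sym (*-suc 2 j))) (trans (xi-odd p' y₁ y₀ j<m) (regroup j y₀ w))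
    X̃-next : X̃ (3 + 2 * j) ≡ (1 + j) * z₁ + z₀ + w̃
    X̃-next = trans (cong (λ i → X̃ (suc i)) (sym (*-suc 2 j))) (trans (xi-odd p z₁ z₀ j<m) (regroup j z₀ w̃))

  last-step : CrossingStep p p' X X̃ (2 + 2 * m)
  last-step =
    crossing-step (xi-even p' y₁ y₀ (≤-refl {m})) (xi-even p z₁ z₀ (≤-refl {m}))
      (trans (xi-last m p' y₁ y₀) (regroup m y₁ y₀)) (trans (xi-last m p z₁ z₀) (regroup m z₁ z₀))
      (crossing (opposite σ) 1 0 (det-antisym (deviation-sheared (+-comm (1 + m) 1)))
        (subst₂ (λ a ã → Det (opposite σ) (p' , p) (a , ã) 0) (regroup m y₁ y₀) (regroup m z₁ z₀) det-self)
        (deviation-bound (s≤s z≤n) ≤-refl) z≤n (Coprimality.sym (det-coprime det)))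
    where
    regroup : ∀ k u u' → (2 + k) * u + u' ≡ (1 + k) * u + u' + u
    regroup = solve-∀

xi-crossing-step : ∀ {σ c y₁ z₁ y₀ z₀ p p' ℓ} → 2 ≤ c → Det σ (y₁ , z₁) (y₀ , z₀) 1 →
                   y₀ ≤ y₁ → z₀ ≤ z₁ → p' ≡ c * y₁ + y₀ → p ≡ c * z₁ + z₀ → ℓ ≤ 2 * c ∸ 2 →
                   CrossingStep p p' (xiGen c p' y₁ y₀) (xiGen c p z₁ z₀) ℓ
xi-crossing-step {c = suc (suc m)} {ℓ = ℓ} (s≤s (s≤s z≤n)) det y₀≤y₁ z₀≤z₁ refl refl ℓ≤
  with m≤n⇒∃[o]m+o≡n y₀≤y₁ | m≤n⇒∃[o]m+o≡n z₀≤z₁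
... | w , refl | w̃ , refl with step-index {m} {ℓ} (subst (ℓ ≤_) (cong (_∸ 2) (*-distribˡ-+ 2 2 m)) ℓ≤)
...   | first = first-step m w w̃ det
...   | odd j≤m = odd-step m w w̃ det j≤m
...   | even j<m = even-step m w w̃ det j<m
...   | last = last-step m w w̃ det

step-length : ∀ (f : ℕ → ℕ) {ℓ d} → f (suc ℓ) ≡ f ℓ + d → f (ℓ + 1) ∸ f ℓ ≡ d
step-length f {ℓ} {d} eq = begin
  f (ℓ + 1) ∸ f ℓ   ≡⟨ cong (λ i → f i ∸ f ℓ) (+-comm ℓ 1) ⟩
  f (suc ℓ) ∸ f ℓ   ≡⟨ cong (_∸ f ℓ) eq ⟩
  f ℓ + d ∸ f ℓ     ≡⟨ m+n∸m≡n (f ℓ) d ⟩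
  d                 ∎
  where open ≡-Reasoning

continuant-det : ∀ c k → ∃ λ σ → Det σ (y c k , z c k) (yPrev c k , zPrev c k) 1
continuant-det c zero = Sign.+ , det+ refl
continuant-det c (suc k) with continuant-det c k
... | σ , det = opposite σ , det-antisym (det-shearʳ (c k) det)

m≤n*m+o : ∀ {n} m o → 1 ≤ n → m ≤ n * m + o
m≤n*m+o {n} m o 1≤n = ≤-trans (m≤n*m m n {{>-nonZero 1≤n}}) (m≤m+n (n * m) o)

seqPair-shift : ∀ c a b k → seqPair c a b (suc k) ≡ seqPair (c ∘ suc) b (c 0 * b + a) k
seqPair-shift c a b zero = refl
seqPair-shift c a b (suc k) = cong (λ s → proj₂ s , c (suc k) * proj₂ s + proj₁ s) (seqPair-shift c a b k)

cfEval-shift : ∀ c i m → cfEval c (suc i) m ≡ cfEval (c ∘ suc) i m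
cfEval-shift c i zero = refl
cfEval-shift c i (suc m) = cong (λ s → c (suc i) * proj₁ s + proj₂ s , proj₁ s) (cfEval-shift c (suc i) m)

seqPair-cfEval : ∀ c m a b →
                 proj₂ (seqPair c a b (suc m)) ≡ b * proj₁ (cfEval c 0 m) + a * proj₂ (cfEval c 0 m)
seqPair-cfEval c zero a b = cong₂ _+_ (*-comm (c 0) b) (sym (*-identityʳ a))
seqPair-cfEval c (suc m) a b = begin
  proj₂ (seqPair c a b (suc (suc m)))                ≡⟨ cong proj₂ (seqPair-shift c a b (suc m)) ⟩
  proj₂ (seqPair (c ∘ suc) b (c 0 * b + a) (suc m))  ≡⟨ seqPair-cfEval (c ∘ suc) m b (c 0 * b + a) ⟩
  (c 0 * b + a) * N + b * D                          ≡⟨ regroup (c 0) a b N D ⟩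
  b * (c 0 * N + D) + a * N
    ≡⟨ cong (λ s → b * (c 0 * proj₁ s + proj₂ s) + a * proj₁ s) (cfEval-shift c 0 m) ⟨
  b * proj₁ (cfEval c 0 (suc m)) + a * proj₂ (cfEval c 0 (suc m)) ∎
  where
  open ≡-Reasoning
  N = proj₁ (cfEval (c ∘ suc) 0 m)
  D = proj₂ (cfEval (c ∘ suc) 0 m)
  regroup : ∀ x a b N D → (x * b + a) * N + b * D ≡ b * (x * N + D) + a * N
  regroup = solve-∀

cfEval-continuants : ∀ c n → proj₁ (cfEval c 0 n) ≡ y c (suc n) × proj₂ (cfEval c 0 n) ≡ z c (suc n)
cfEval-continuants c n =
  sym (trans (seqPair-cfEval c n 0 1) (trans (+-identityʳ _) (*-identityˡ _))) ,
  sym (trans (seqPair-cfEval c n 1 0) (*-identityˡ _))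

coprime-cross⇒≡ : ∀ {a b a' b'} .{{_ : NonZero a}} → Coprime a b → Coprime a' b' →
                  a * b' ≡ a' * b → a ≡ a' × b ≡ b'
coprime-cross⇒≡ {a} {b} {a'} {b'} coprime coprime' eq = a≡a' , b≡b'
  where
  a∣a' : a ∣ a'
  a∣a' = coprime-divisor coprime (subst (a ∣_) (trans eq (*-comm a' b)) (m∣m*n b'))
  a'∣a : a' ∣ a
  a'∣a = coprime-divisor coprime' (subst (a' ∣_) (trans (sym eq) (*-comm a b')) (m∣m*n b))
  a≡a' = ∣-antisym a∣a' a'∣a
  b≡b' = *-cancelˡ-≡ b b' a (trans (cong (_* b) a≡a') (sym eq))

cf-continuants : ∀ {p p' n c} → Coprime p p' → 0 < p' → IsCF p' p n c →
                 p' ≡ y c (suc n) × p ≡ z c (suc n)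
cf-continuants {p} {p'} {n} {c} coprime 0<p' cf =
  coprime-cross⇒≡ {{>-nonZero 0<p'}} (Coprimality.sym coprime)
    (det-coprime (proj₂ (continuant-det c (suc n)))) value
  where
  value : p' * z c (suc n) ≡ y c (suc n) * p
  value = subst₂ (λ N D → p' * D ≡ N * p)
    (proj₁ (cfEval-continuants c n)) (proj₂ (cfEval-continuants c n)) (IsCF.val cf)

cf-crossing-step : ∀ {p p' n c ℓ} → Coprime p p' → p < p' → IsCF p' p (suc n) c →
                   ℓ ≤ 2 * c (suc n) ∸ 2 →
                   CrossingStep p p' (ξ p' (suc n) c) (ξ̃ p (suc n) c) ℓ
cf-crossing-step {p} {p'} {n} {c} coprime p<p' cf =
  xi-crossing-step (IsCF.last cf) (proj₂ (continuant-det c (suc n)))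
    (m≤n*m+o (y c n) (yPrev c n) 1≤cₙ₋₁) (m≤n*m+o (z c n) (zPrev c n) 1≤cₙ₋₁)
    (proj₁ continuants) (proj₂ continuants)
  where
  1≤cₙ₋₁ = IsCF.pos cf n ≤-refl
  continuants = cf-continuants coprime (≤-trans (s≤s z≤n) p<p') cf

≤∸2⇒+1< : ∀ {s q} → 1 ≤ s → s ≤ q ∸ 2 → s + 1 < q
≤∸2⇒+1< {s} {suc (suc q)} _ s≤q = s≤s (subst (_≤ suc q) (+-comm 1 s) (s≤s s≤q))
≤∸2⇒+1< {suc _} {zero} _ ()
≤∸2⇒+1< {suc _} {suc zero} _ ()

theoremE11 : (p p' n : ℕ) (c : ℕ → ℕ) → Coprime p p' → 1 ≤ p → p < p' →
    IsCF p' p n c → 1 ≤ n → (ℓ : ℕ) → ℓ ≤ 2 * c n ∸ 2 →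
    (s : ℕ) → 1 ≤ s → s ≤ (ξ p' n c (ℓ + 1) ∸ ξ p' n c ℓ) ∸ 2 →
    OddBand (ξ̃ p n c (ℓ + 1) ∸ ξ̃ p n c ℓ) (ξ p' n c (ℓ + 1) ∸ ξ p' n c ℓ) s
      ⇔ OddBand p p' (ξ p' n c ℓ + s)
theoremE11 p p' (suc n) c coprime _ p<p' cf (s≤s z≤n) ℓ ℓ≤ s 1≤s s≤ =
  subst₂ (λ q q' → OddBand q q' s ⇔ OddBand p p' (ξ p' (suc n) c ℓ + s)) (sym Q-length) (sym Q'-length)
    (bands-agree {p} {p'} {ξ p' (suc n) c ℓ} (crossing-floor (≤-trans (s≤s z≤n) p<p') segment) 1≤s
      (≤∸2⇒+1< 1≤s (subst (λ q' → s ≤ q' ∸ 2) Q'-length s≤)))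
  where
  open CrossingStep (cf-crossing-step coprime p<p' cf ℓ≤)
  Q'-length = step-length (ξ p' (suc n) c) X-step
  Q-length = step-length (ξ̃ p (suc n) c) X̃-step
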